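{- Let $G$ be a connected graph containing at least one even cycle. Then: (a) $\chi(G)\leq \ell_e(G)+1$; (b) if $w(G)\leq \ell_e(G)$ and $|L_e(G)|\geq 3$, then $\chi(G)\leq \ell_e(G)$; (c) if $w(G)\leq \ell_e(G)-1$ and $|L_e(G)|\geq 3$, then $\chi(G)\leq \ell_e(G)-1$.
   Context: All graphs are finite, simple and undirected. $L_e(G)$ denotes the set of all even integers $m$ such that $G$ contains a cycle of length $m$, and $\ell_e(G)$ denotes the length of a longest even cycle in $G$. $w(G)$ denotes the clique number of $G$ (the number of vertices of a largest clique) and $\chi(G)$ the chromatic number. -}

module Defs where

open import Data.Fin.Base using (Fin; zero; suc; inject₁; fromℕ)
open import Data.Fin.Subset using (Subset; ∣_∣) renaming (_∈_ to _∈ₛ_)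
open import Data.List.Base using (List; length)
open import Data.List.Membership.Propositional using (_∈_)
open import Data.List.Relation.Unary.Unique.Propositional using (Unique)
open import Data.Nat.Base using (ℕ; suc; _≤_)
open import Data.Nat.Divisibility using (_∣_)
open import Data.Product.Base using (_×_; ∃)
open import Function.Bundles using (_⇔_)
open import Function.Definitions using (Injective)
open import Level using (0ℓ)
open import Relation.Binary.Core using (Rel)
open import Relation.Binary.Construct.Closure.ReflexiveTransitive using (Star)
open import Relation.Binary.Definitions using (Decidable; Irreflexive; Symmetric)
open import Relation.Binary.PropositionalEquality using (_≡_; _≢_)
open import Relation.Unary using (Pred)

IsGreatest : Pred ℕ 0ℓ → Pred ℕ 0ℓ
IsGreatest P m = P m × (∀ k → P k → k ≤ m)

IsLeast : Pred ℕ 0ℓ → Pred ℕ 0ℓ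
IsLeast P m = P m × (∀ k → P k → m ≤ k)

-- Cardinality of { m | P m } as a set of numbers.  An enumeration of the
-- values is used, rather than a bijection between Fin c and ∃ P, because P
-- may be proof-relevant.
HasCardinality : Pred ℕ 0ℓ → Pred ℕ 0ℓ
HasCardinality P c =
  ∃ λ (xs : List ℕ) → Unique xs × (∀ m → m ∈ xs ⇔ P m) × length xs ≡ c

record Graph (n : ℕ) : Set₁ where
  field
    Adj    : Rel (Fin n) 0ℓ
    adj?   : Decidable Adj
    sym    : Symmetric Adj
    irrefl : Irreflexive _≡_ Adj

module _ {n : ℕ} (G : Graph n) where
  open Graph G

  Connected : Set
  Connected = ∀ u v → Star Adj u v

  -- The cycle v₀ v₁ … vₖ v₀ on k + 1 ≥ 3 distinct vertices.
  record Cycle : Set where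
    field
      k         : ℕ
      2≤k       : 2 ≤ k
      vertex    : Fin (suc k) → Fin n
      injective : Injective _≡_ _≡_ vertex
      step      : ∀ (i : Fin k) → Adj (vertex (inject₁ i)) (vertex (suc i))
      close     : Adj (vertex (fromℕ k)) (vertex zero)

    cycleLength : ℕ
    cycleLength = suc k

  Lₑ : Pred ℕ 0ℓ
  Lₑ m = 2 ∣ m × ∃ λ (C : Cycle) → Cycle.cycleLength C ≡ m

  IsLongestEvenCycleLength : Pred ℕ 0ℓ
  IsLongestEvenCycleLength = IsGreatest Lₑ

  IsClique : Pred (Subset n) 0ℓ
  IsClique S = ∀ {u v} → u ∈ₛ S → v ∈ₛ S → u ≢ v → Adj u v

  IsCliqueNumber : Pred ℕ 0ℓ
  IsCliqueNumber = IsGreatest λ k → ∃ λ S → IsClique S × ∣ S ∣ ≡ k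

  Colourable : Pred ℕ 0ℓ
  Colourable k =
    ∃ λ (c : Fin n → Fin k) → ∀ {u v} → Adj u v → c u ≢ c v

  IsChromaticNumber : Pred ℕ 0ℓ
  IsChromaticNumber = IsLeast Colourable

{-# OPTIONS --safe #-}
module Submission where

-- Let k = ℓₑ / 2 and let U induce a subgraph that is not K-colourable although all its
-- proper induced subgraphs are; then every vertex of U has K neighbours in U.  Take a
-- longest path f 0, …, f (L − 1) in U and, among the longest ones, one whose first vertex
-- is adjacent to f t with t as large as possible.  Every neighbour of f 0, and of the
-- first vertex of any path obtained by rotation, is among f 0, …, f t.  Each neighbour
-- closes a cycle, so if t is odd then t < 2 k, and if t is even only 2 k positions are
-- available; hence K ≤ 2 k, which is (a).
--
-- For (b) and (c) let 2 k ≤ K + 1 and k ≥ 4, so that at most one available position can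
-- be missing.  If t = 2 s with s > k, crossing chords f 0 ~ f (2 e + 1) and
-- f (2 e) ~ f (2 i + 1), i ≥ k, would give an even cycle of length 2 i + 2 > 2 k, and
-- avoiding all of these leaves some vertex with two positions missing.  So t ∈ {K , K + 1}.
-- If t = K then f 0, …, f t is a clique.  If t = K + 1 then only f t has neighbours off
-- the cycle, and without a clique of size K + 1 the cycle has two disjoint non-edges, so K
-- colours suffice on it and a colouring of the remaining vertices extends.

open import Defs
open import Data.Empty using (⊥; ⊥-elim)
open import Data.Fin.Base using (Fin; zero; suc; toℕ; fromℕ; fromℕ<; inject₁; punchIn; punchOut)
open import Data.Fin.Permutation.Components using (transpose; transpose-inverse)
import Data.Fin.Properties as Fin
open import Data.Fin.Subset using (Subset; ∣_∣; _∈_; _⊂_; _-_; ⊤)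
open import Data.Fin.Subset.Induction using (⊂-wellFounded)
open import Data.Fin.Subset.Properties
  using (_∈?_; ∈⊤; nonempty?; x∈p⇒p-x⊂p; x∈p⇒∣p-x∣<∣p∣; x∈p∧x≢y⇒x∈p-y)
open import Data.List.Base using (List; []; _∷_; _++_; length; lookup; tabulate)
open import Data.List.Membership.Propositional using () renaming (_∈_ to _∈ₗ_)
open import Data.List.Membership.Propositional.Properties using (∈-tabulate⁻; ∈-lookup)
open import Data.List.Relation.Binary.Disjoint.Propositional using (Disjoint)
open import Data.List.Properties using (length-++; length-tabulate)
open import Data.List.Relation.Unary.All as All using (All; []; _∷_)
import Data.List.Relation.Unary.All.Properties as All
open import Data.List.Relation.Unary.AllPairs using ([]; _∷_)
open import Data.List.Relation.Unary.Any using (here; there)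
open import Data.List.Relation.Unary.Unique.Propositional using (Unique)
import Data.List.Relation.Unary.Unique.Propositional.Properties as Unique
open import Data.Nat.Base
open import Data.Nat.Divisibility using (divides)
open import Data.Nat.Properties
open import Data.Nat.Tactic.RingSolver using (solve-∀)
open import Data.Product.Base using (_×_; ∃; ∃₂; _,_; proj₁; proj₂)
open import Data.Sum.Base using (_⊎_; inj₁; inj₂; [_,_]′)
import Data.Vec.Base as Vec
open import Data.Vec.Properties using (lookup∘tabulate; []=⇒lookup; lookup⇒[]=)
open import Function.Base using (_∘_; id)
open import Function.Bundles using (module Equivalence)
open import Function.Definitions using (Injective)
open import Induction.WellFounded using (Acc; acc)
open import Level using (0ℓ)
open import Relation.Binary.PropositionalEquality
  using (_≡_; _≢_; refl; sym; trans; cong; subst; subst₂)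
open import Relation.Nullary using (¬_; Dec; yes; no; does; contradiction)
open import Relation.Nullary.Decidable using (decidable-stable; ¬?; _×-dec_; _⊎-dec_; dec-true)
open import Relation.Unary using (Pred; Decidable)


-- Maxima, counting, concatenated sequences and maps merging two values

private variable
  A : Set
  n m : ℕ

-- `climb` maintains `B < f a + d`: a strictly larger value pays for lowering `d`, and `d = 0`
-- contradicts the bound. The double negation is needed because `A` is arbitrary and cannot be
-- searched.
maximum-exists : (f : A → ℕ) (B : ℕ) → (∀ a → f a ≤ B) → A →
                 ¬ ¬ ∃ λ a → ∀ b → f b ≤ f a
maximum-exists f B bound a k = climb (suc B) a (m≤n+m (suc B) (f a))
  where
  climb : ∀ d a → B < f a + d → ⊥
  climb zero    a B<fa = <⇒≱ (subst (B <_) (+-identityʳ _) B<fa) (bound a)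
  climb (suc d) a B<fa = k (a , λ b → ≮⇒≥ λ fa<fb →
    climb d b (≤-trans (subst (B <_) (+-suc (f a) d) B<fa) (+-monoˡ-≤ d fa<fb)))

even-or-odd : ∀ q → ∃ λ j → q ≡ 2 * j ⊎ q ≡ 1 + 2 * j
even-or-odd zero = 0 , inj₁ refl
even-or-odd (suc q) with even-or-odd q
... | j , inj₁ refl = j , inj₂ refl
... | j , inj₂ refl = suc j , inj₁ (sym (*-suc 2 j))

lookup-injective : {xs : List A} → Unique xs → Injective _≡_ _≡_ (lookup xs)
lookup-injective (_ ∷ _)      {zero}  {zero}  _  = refl
lookup-injective (x∉xs ∷ _)   {zero}  {suc j} eq = contradiction eq (All.lookup x∉xs (∈-lookup j))
lookup-injective (x∉xs ∷ _)   {suc i} {zero}  eq = contradiction (sym eq) (All.lookup x∉xs (∈-lookup i))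
lookup-injective (_ ∷ uniq)   {suc i} {suc j} eq = cong suc (lookup-injective uniq eq)

unique-bounded-length : {xs : List ℕ} {B : ℕ} → Unique xs → All (_< B) xs → length xs ≤ B
unique-bounded-length {xs} {B} uniq bounded = Fin.injective⇒≤ {f = f} λ {i} {j} eq →
  lookup-injective uniq (Fin.fromℕ<-injective _ _ (small i) (small j) eq)
  where
  small : ∀ i → lookup xs i < B
  small i = All.lookup bounded (∈-lookup i)
  f : Fin (length xs) → Fin B
  f i = fromℕ< (small i)

join : (ℕ → A) → ℕ → (ℕ → A) → ℕ → A
join f zero    g i       = g i
join f (suc a) g zero    = f 0
join f (suc a) g (suc i) = join (f ∘ suc) a g i

join-< : ∀ (f : ℕ → A) a g {i} → i < a → join f a g i ≡ f i
join-< f (suc a) g {zero}  _   = refl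
join-< f (suc a) g {suc i} i<a = join-< (f ∘ suc) a g (s<s⁻¹ i<a)

join-+ : ∀ (f : ℕ → A) a g j → join f a g (a + j) ≡ g j
join-+ f zero    g j = refl
join-+ f (suc a) g j = join-+ (f ∘ suc) a g j

split : ∀ a i → i < a ⊎ ∃ λ j → i ≡ a + j
split a i with i <? a
... | yes i<a = inj₁ i<a
... | no  i≮a = inj₂ (i ∸ a , sym (m+[n∸m]≡n (≮⇒≥ i≮a)))

comprehension : {P : Pred (Fin n) 0ℓ} → Decidable P → Subset n
comprehension P? = Vec.tabulate (does ∘ P?)

∈-comprehension⁺ : ∀ {P : Pred (Fin n) 0ℓ} (P? : Decidable P) {x} → P x → x ∈ comprehension P?
∈-comprehension⁺ P? {x} px =
  lookup⇒[]= x _ (trans (lookup∘tabulate _ x) (dec-true (P? x) px))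

∈-comprehension⁻ : ∀ {P : Pred (Fin n) 0ℓ} (P? : Decidable P) {x} → x ∈ comprehension P? → P x
∈-comprehension⁻ P? {x} x∈ with P? x | trans (sym (lookup∘tabulate (does ∘ P?) x)) ([]=⇒lookup x∈)
... | yes px | _ = px

injection⇒≤∣∣ : ∀ {S : Subset n} (g : Fin m → Fin n) → Injective _≡_ _≡_ g →
                (∀ i → g i ∈ S) → m ≤ ∣ S ∣
injection⇒≤∣∣ {m = zero}      g inj g∈S = z≤n
injection⇒≤∣∣ {m = suc m} {S} g inj g∈S = ≤-trans
  (s≤s (injection⇒≤∣∣ {S = S - g zero} (g ∘ suc) (Fin.suc-injective ∘ inj)
    λ i → x∈p∧x≢y⇒x∈p-y (g∈S (suc i)) λ eq → Fin.0≢1+n (sym (inj eq))))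
  (x∈p⇒∣p-x∣<∣p∣ (g∈S zero))

SamePair : (p q i j : A) → Set
SamePair p q i j = (i ≡ p × j ≡ q) ⊎ (i ≡ q × j ≡ p)

-- Send `q` to `p`, then close the gap left at `q` with `punchOut`.
merge : ∀ {p q : Fin (suc m)} → p ≢ q →
        ∃ λ (φ : Fin (suc m) → Fin m) → ∀ {i j} → φ i ≡ φ j → i ≡ j ⊎ SamePair p q i j
merge {m} {p} {q} p≢q = φ , φ-injective
  where
  redirect : ∀ i → ∃ λ i′ → q ≢ i′ × ((i ≡ q × i′ ≡ p) ⊎ i′ ≡ i)
  redirect i with i Fin.≟ q
  ... | yes i≡q = p , p≢q ∘ sym , inj₁ (i≡q , refl)
  ... | no  i≢q = i , i≢q ∘ sym , inj₂ refl
  φ : Fin (suc m) → Fin m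
  φ i = punchOut (proj₁ (proj₂ (redirect i)))
  φ-injective : ∀ {i j} → φ i ≡ φ j → i ≡ j ⊎ SamePair p q i j
  φ-injective {i} {j} eq with redirect i | redirect j
  ... | i′ , q≢i′ , ri | j′ , q≢j′ , rj
    with ri | rj | Fin.punchOut-injective q≢i′ q≢j′ eq
  ... | inj₁ (i≡q , _)    | inj₁ (j≡q , _)    | _   = inj₁ (trans i≡q (sym j≡q))
  ... | inj₁ (i≡q , refl) | inj₂ refl         | eq′ = inj₂ (inj₂ (i≡q , sym eq′))
  ... | inj₂ refl         | inj₁ (j≡q , refl) | eq′ = inj₂ (inj₁ (eq′ , j≡q))
  ... | inj₂ refl         | inj₂ refl         | eq′ = inj₁ eq′

-- The first merge identifies neither `r` nor `s` with anything else (`single`), so their images are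
-- distinct and the second merge creates only one further collision.
merge₂ : ∀ {p q r s : Fin (suc (suc m))} →
         p ≢ q → r ≢ s → r ≢ p → r ≢ q → s ≢ p → s ≢ q →
         ∃ λ (φ : Fin (suc (suc m)) → Fin m) →
         ∀ {i j} → φ i ≡ φ j → i ≡ j ⊎ SamePair p q i j ⊎ SamePair r s i j
merge₂ {m} {p} {q} {r} {s} p≢q r≢s r≢p r≢q s≢p s≢q with merge p≢q
... | φ₁ , φ₁-injective = compose (merge (r≢s ∘ single s≢p s≢q))
  where
  single : ∀ {i x} → x ≢ p → x ≢ q → φ₁ i ≡ φ₁ x → i ≡ x
  single x≢p x≢q eq with φ₁-injective eq
  ... | inj₁ i≡x              = i≡x
  ... | inj₂ (inj₁ (_ , x≡q)) = contradiction x≡q x≢q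
  ... | inj₂ (inj₂ (_ , x≡p)) = contradiction x≡p x≢p
  compose : (∃ λ (φ₂ : Fin (suc m) → Fin m) →
             ∀ {i j} → φ₂ i ≡ φ₂ j → i ≡ j ⊎ SamePair (φ₁ r) (φ₁ s) i j) →
            ∃ λ (φ : Fin (suc (suc m)) → Fin m) →
            ∀ {i j} → φ i ≡ φ j → i ≡ j ⊎ SamePair p q i j ⊎ SamePair r s i j
  compose (φ₂ , φ₂-injective) = φ₂ ∘ φ₁ , injective
    where
    injective : ∀ {i j} → φ₂ (φ₁ i) ≡ φ₂ (φ₁ j) → i ≡ j ⊎ SamePair p q i j ⊎ SamePair r s i j
    injective eq with φ₂-injective eq
    ... | inj₂ (inj₁ (i~r , j~s)) = inj₂ (inj₂ (inj₁ (single r≢p r≢q i~r , single s≢p s≢q j~s)))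
    ... | inj₂ (inj₂ (i~s , j~r)) = inj₂ (inj₂ (inj₂ (single s≢p s≢q i~s , single r≢p r≢q j~r)))
    ... | inj₁ same with φ₁-injective same
    ...   | inj₁ i≡j = inj₁ i≡j
    ...   | inj₂ p~q = inj₂ (inj₁ p~q)

-- Paths and the cycles they close

module Paths {n : ℕ} (G : Graph n) (U : Subset n) where
  open Graph G renaming (sym to adj-sym)

  adj⇒≢ : ∀ {u v} → Adj u v → u ≢ v
  adj⇒≢ uv eq = irrefl eq uv


  -- A path is a total function on `ℕ` of which only the values below `L` count, so reversing,
  -- cutting and joining paths is index arithmetic.
  record IsPath (f : ℕ → Fin n) (L : ℕ) : Set where
    field
      inj    : ∀ {i j} → i < L → j < L → f i ≡ f j → i ≡ j
      step   : ∀ {i} → suc i < L → Adj (f i) (f (suc i))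
      inside : ∀ {i} → i < L → f i ∈ U

  open IsPath public

  path-length : ∀ {f L} → IsPath f L → L ≤ n
  path-length {f} {L} p = Fin.injective⇒≤ {f = f ∘ toℕ} λ {i} {j} eq →
    Fin.toℕ-injective (inj p (Fin.toℕ<n i) (Fin.toℕ<n j) eq)

  join-path : ∀ {f a g b} → IsPath f (suc a) → IsPath g b →
              (∀ {i j} → i ≤ a → j < b → f i ≢ g j) → (0 < b → Adj (f a) (g 0)) →
              IsPath (join f (suc a) g) (suc a + b)
  join-path {f} {a} {g} {b} p q disjoint joint = record
    { inj = injective ; step = λ {i} → steps i ; inside = λ {i} → insides i }
    where
    h = join f (suc a) g
    injective : ∀ {i j} → i < suc a + b → j < suc a + b → h i ≡ h j → i ≡ j
    injective {i} {j} i< j< eq with split (suc a) i | split (suc a) j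
    ... | inj₁ i<a | inj₁ j<a = inj p i<a j<a
      (trans (sym (join-< f (suc a) g i<a)) (trans eq (join-< f (suc a) g j<a)))
    ... | inj₁ i<a | inj₂ (j′ , refl) = ⊥-elim (disjoint (s≤s⁻¹ i<a) (+-cancelˡ-< _ _ _ j<)
      (trans (sym (join-< f (suc a) g i<a)) (trans eq (join-+ f (suc a) g j′))))
    ... | inj₂ (i′ , refl) | inj₁ j<a = ⊥-elim (disjoint (s≤s⁻¹ j<a) (+-cancelˡ-< _ _ _ i<)
      (trans (sym (join-< f (suc a) g j<a)) (trans (sym eq) (join-+ f (suc a) g i′))))
    ... | inj₂ (i′ , refl) | inj₂ (j′ , refl) = cong (suc a +_)
      (inj q (+-cancelˡ-< _ _ _ i<) (+-cancelˡ-< _ _ _ j<)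
        (trans (sym (join-+ f (suc a) g i′)) (trans eq (join-+ f (suc a) g j′))))
    steps : ∀ i → suc i < suc a + b → Adj (h i) (h (suc i))
    steps i i< with split (suc a) (suc i)
    ... | inj₁ i<a = subst₂ Adj (sym (join-< f (suc a) g (<-trans (n<1+n i) i<a)))
      (sym (join-< f (suc a) g i<a)) (step p i<a)
    ... | inj₂ (zero , eq) rewrite suc-injective (trans eq (+-identityʳ (suc a))) =
      subst₂ Adj (sym (join-< f (suc a) g ≤-refl))
        (trans (sym (join-+ f (suc a) g 0)) (cong h (+-identityʳ (suc a))))
        (joint (≤-trans (s≤s z≤n) (+-cancelˡ-< (suc a) 0 b
          (subst (_< suc a + b) (sym (+-identityʳ (suc a))) i<))))
    ... | inj₂ (suc j , eq) rewrite suc-injective (trans eq (+-suc (suc a) j)) =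
      subst₂ Adj (sym (join-+ f (suc a) g j))
        (trans (sym (join-+ f (suc a) g (suc j))) (cong h (+-suc (suc a) j)))
        (step q (+-cancelˡ-< (suc a) (suc j) b (subst (_< suc a + b) (sym (+-suc (suc a) j)) i<)))
    insides : ∀ i → i < suc a + b → h i ∈ U
    insides i i< with split (suc a) i
    ... | inj₁ i<a = subst (_∈ U) (sym (join-< f (suc a) g i<a)) (inside p i<a)
    ... | inj₂ (j , refl) =
      subst (_∈ U) (sym (join-+ f (suc a) g j)) (inside q (+-cancelˡ-< _ _ _ i<))

  reverse-path : ∀ {f a} → IsPath f (suc a) → IsPath (λ i → f (a ∸ i)) (suc a)
  reverse-path {f} {a} p = record
    { inj    = λ {i} {j} i≤a j≤a eq → ∸-cancelˡ-≡ (s≤s⁻¹ i≤a) (s≤s⁻¹ j≤a)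
                 (inj p (s≤s (m∸n≤m a i)) (s≤s (m∸n≤m a j)) eq)
    ; step   = λ {i} i<a → let eq = sym (+-∸-assoc 1 {a} {suc i} (s≤s⁻¹ i<a)) in
                 adj-sym (subst (λ z → Adj (f (a ∸ suc i)) (f z)) eq
                   (step p (subst (_< suc a) (sym eq) (s≤s (m∸n≤m a i)))))
    ; inside = λ {i} _ → inside p (s≤s (m∸n≤m a i))
    }

  segment-path : ∀ {f L} a {b} → IsPath f L → a + b ≤ L → IsPath (λ i → f (a + i)) b
  segment-path {f} {L} a {b} p a+b≤L = record
    { inj    = λ i< j< eq → +-cancelˡ-≡ a _ _ (inj p (in-range i<) (in-range j<) eq)
    ; step   = λ {i} i< → subst (λ z → Adj (f (a + i)) (f z)) (sym (+-suc a i))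
                 (step p (subst (_< L) (+-suc a i) (in-range i<)))
    ; inside = inside p ∘ in-range
    }
    where
    in-range : ∀ {i} → i < b → a + i < L
    in-range i<b = <-≤-trans (+-monoʳ-< a i<b) a+b≤L

  path⇒cycle : ∀ {f m} → IsPath f (suc m) → 2 ≤ m → Adj (f m) (f 0) →
               ∃ λ (C : Cycle G) → Cycle.cycleLength C ≡ suc m
  path⇒cycle {f} {m} p 2≤m closing = record
    { k = m ; 2≤k = 2≤m ; vertex = f ∘ toℕ
    ; injective = λ {i} {j} eq → Fin.toℕ-injective (inj p (Fin.toℕ<n i) (Fin.toℕ<n j) eq)
    ; step = λ i → subst (λ z → Adj (f z) (f (suc (toℕ i)))) (sym (Fin.toℕ-inject₁ i))
        (step p (s≤s (Fin.toℕ<n i)))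
    ; close = subst (λ z → Adj (f z) (f 0)) (sym (Fin.toℕ-fromℕ m)) closing
    } , refl

-- Chords, rotations and odd cycles when even cycles are bounded

module Cycles {n : ℕ} (G : Graph n) (U : Subset n) (k : ℕ) (1≤k : 1 ≤ k)
  (even-bound : ∀ (C : Cycle G) j → Cycle.cycleLength C ≡ 2 * j → j ≤ k) where
  open Graph G renaming (sym to adj-sym)
  open Paths G U public

  -- Follow the path from `f 0` to `f x`, jump to `f (b + y)`, go back to `f b` and return to `f 0`:
  -- a cycle on `x + y + 2` vertices. Taking `x = 0`, `b = 1` and a path edge as first chord covers
  -- the case of a single chord.
  chord-bound : ∀ {f L x b y} j → IsPath f L → x < b → b + y < L →
                Adj (f 0) (f b) → Adj (f x) (f (b + y)) → x + y ≡ 2 * j → j < k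
  -- Here the closed walk has only two vertices and is no cycle; `0 < k` is the hypothesis.
  chord-bound zero _ _ _ _ _ _ = 1≤k
  chord-bound {f} {L} {x} {b} {y} (suc j) p x<b b+y<L first last x+y≡2j
    with path⇒cycle (join-path initial final disjoint λ _ → last) 2≤m
           (subst (λ z → Adj z (f 0)) (sym end) (adj-sym first))
    where
    back : ℕ → Fin n
    back i = f (b + (y ∸ i))
    initial : IsPath f (suc x)
    initial = segment-path 0 p (<-≤-trans x<b (≤-trans (m≤m+n b y) (<⇒≤ b+y<L)))
    final : IsPath back (suc y)
    final = reverse-path (segment-path b p (subst (_≤ L) (sym (+-suc b y)) b+y<L))
    disjoint : ∀ {i j} → i ≤ x → j < suc y → f i ≢ back j
    disjoint {i} {j} i≤x _ eq = <-irrefl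
      (inj p (<-≤-trans i<b (≤-trans (m≤m+n b y) (<⇒≤ b+y<L)))
             (≤-<-trans (+-monoʳ-≤ b (m∸n≤m y j)) b+y<L) eq)
      (<-≤-trans i<b (m≤m+n b (y ∸ j)))
      where i<b = ≤-<-trans i≤x x<b
    2≤m : 2 ≤ x + suc y
    2≤m = subst (2 ≤_) (sym (trans (+-suc x y) (cong suc x+y≡2j))) (s≤s (s≤s z≤n))
    end : join f (suc x) back (x + suc y) ≡ f b
    end = trans (cong (join f (suc x) back) (+-suc x y)) (trans (join-+ f (suc x) back y)
      (cong f (trans (cong (b +_) (n∸n≡0 y)) (+-identityʳ b))))
  ... | C , length≡ = even-bound C (suc (suc j)) (trans length≡
    (trans (cong suc (trans (+-suc x y) (cong suc x+y≡2j))) (sym (*-suc 2 (suc j)))))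

  -- Pósa rotation along a chord from `f 0` to `f (suc i)`: the segment up to `f i` is reversed, and
  -- `f i` becomes the first vertex.
  rotate : (ℕ → Fin n) → ℕ → ℕ → Fin n
  rotate f i = join (λ j → f (i ∸ j)) (suc i) (λ j → f (suc i + j))

  rotate-path : ∀ {f L i} → IsPath f L → suc i < L → Adj (f 0) (f (suc i)) →
                IsPath (rotate f i) L
  rotate-path {f} {L} {i} p i<L chord = subst (IsPath (rotate f i)) total
    (join-path (reverse-path (segment-path 0 p (<⇒≤ i<L)))
      (segment-path (suc i) p (≤-reflexive total)) disjoint
      λ _ → subst₂ (λ a b → Adj (f a) (f b)) (sym (n∸n≡0 i)) (sym (+-identityʳ (suc i))) chord)
    where
    total : suc i + (L ∸ suc i) ≡ L
    total = m+[n∸m]≡n (<⇒≤ i<L)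
    disjoint : ∀ {a b} → a ≤ i → b < L ∸ suc i → f (i ∸ a) ≢ f (suc i + b)
    disjoint {a} {b} _ b< eq = <-irrefl
      (inj p (<-trans (s≤s (m∸n≤m i a)) i<L) (subst (suc i + b <_) total (+-monoʳ-< (suc i) b<)) eq)
      (s≤s (≤-trans (m∸n≤m i a) (m≤m+n i b)))

  -- A rotation at `i < t` only permutes the positions up to `t`, so closure of the rotated path
  -- carries over to `f`.
  rotate-range : ∀ f {i t} q → i < t → q ≤ t → ∃ λ q′ → q′ ≤ t × rotate f i q ≡ f q′
  rotate-range f {i} {t} q i<t q≤t with split (suc i) q
  ... | inj₁ q<i         = i ∸ q , ≤-trans (m∸n≤m i q) (<⇒≤ i<t) , join-< _ (suc i) _ q<i
  ... | inj₂ (j , refl) = suc i + j , q≤t , join-+ (λ j → f (i ∸ j)) (suc i) _ j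

  Closed : (ℕ → Fin n) → ℕ → ℕ → Set
  Closed f t i = ∀ {z} → z ∈ U → Adj (f i) z → ∃ λ q → q ≤ t × z ≡ f q

  -- The cycle f 0, …, f t read off from its vertex f p, where p + r = t.
  unroll : (ℕ → Fin n) → ℕ → ℕ → ℕ → Fin n
  unroll f p r = join (λ j → f (p + j)) (suc r) f

  unroll-path : ∀ {f r} p → IsPath f (suc (p + r)) → Adj (f (p + r)) (f 0) →
                IsPath (unroll f p r) (suc (p + r))
  unroll-path {f} {r} p path closing = subst (IsPath (unroll f p r)) (cong suc (+-comm r p))
    (join-path (segment-path p path (≤-reflexive (+-suc p r)))
      (segment-path 0 path (≤-trans (m≤m+n p r) (n≤1+n _))) disjoint λ _ → closing)
    where
    disjoint : ∀ {i j} → i ≤ r → j < p → f (p + i) ≢ f j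
    disjoint {i} {j} i≤r j<p eq = <-irrefl
      (sym (inj path (s≤s (+-monoʳ-≤ p i≤r)) (<-trans j<p (s≤s (m≤m+n p r))) eq))
      (<-≤-trans j<p (m≤m+n p i))

  -- The closing edge is the path edge between `f p` and its predecessor, or the original closing
  -- edge if `p = 0`.
  unroll-closing : ∀ {f} p r → IsPath f (suc (p + r)) → Adj (f (p + r)) (f 0) →
                   Adj (unroll f p r 0) (unroll f p r (p + r))
  unroll-closing {f} zero r path closing =
    adj-sym (subst (λ z → Adj z (f 0)) (sym (join-< f (suc r) f ≤-refl)) closing)
  unroll-closing {f} (suc p) r path closing = subst₂ Adj (cong f (sym (+-identityʳ (suc p))))
    (trans (sym (join-+ (λ j → f (suc p + j)) (suc r) f p)) (cong (unroll f (suc p) r ∘ suc) (+-comm r p)))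
    (adj-sym (step path (s≤s (s≤s (m≤m+n p r)))))

  unroll-closed : ∀ {f} p r → Closed f (p + r) p → Closed (unroll f p r) (p + r) 0
  unroll-closed {f} p r closed z∈U adj with closed z∈U (subst (λ z → Adj (f z) _) (+-identityʳ p) adj)
  ... | q , q≤t , refl with split p q
  ...   | inj₁ q<p = suc r + q ,
                     subst (suc r + q ≤_) (+-comm r p) (subst (_≤ r + p) (+-suc r q) (+-monoʳ-≤ r q<p)) ,
                     sym (join-+ (λ j → f (p + j)) (suc r) f q)
  ...   | inj₂ (j , refl) = j , ≤-trans (m≤n+m j p) q≤t ,
                     sym (join-< (λ j → f (p + j)) (suc r) f (s≤s (+-cancelˡ-≤ p _ _ q≤t)))

  -- Neighbours of h 0 on an odd cycle h 0, …, h (2 s): an odd index must be below 2 k,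
  -- and an even one must exceed 2 s − 2 k.
  slot : (ℕ → Fin n) → ℕ → ℕ → Fin n
  slot h s = join (λ j → h (1 + 2 * j)) k (λ j → h (2 * s ∸ 2 * j))

  slot-cover : ∀ {h} s {L} → IsPath h L → 2 * s < L → Adj (h 0) (h (2 * s)) → Closed h (2 * s) 0 →
               ∀ {z} → z ∈ U → Adj (h 0) z → ∃ λ m → m < k + k × z ≡ slot h s m
  slot-cover {h} s {L} path t<L closing closed z∈U adj with closed z∈U adj
  ... | q , q≤t , refl with even-or-odd q
  ... | j , inj₂ refl = j , ≤-trans j<k (m≤m+n k k) , sym (join-< (λ j → h (1 + 2 * j)) k _ j<k)
    where
    j<k : j < k
    j<k = chord-bound j path (s≤s z≤n) (≤-<-trans q≤t t<L)
      (step path (≤-<-trans (≤-trans (s≤s z≤n) q≤t) t<L)) adj refl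
  ... | zero , inj₁ refl = ⊥-elim (adj⇒≢ adj refl)
  -- An even chord closes an even cycle the other way round, through `h (2 * s)`, with `2 * j + 2`
  -- vertices.
  ... | suc i , inj₁ refl = k + j , +-monoʳ-< k j<k ,
      trans (cong h (sym position)) (sym (join-+ (λ j → h (1 + 2 * j)) k _ j))
    where
    j = s ∸ suc i
    i≤s : suc i ≤ s
    i≤s = *-cancelˡ-≤ 2 q≤t
    total : 2 * suc i + 2 * j ≡ 2 * s
    total = trans (sym (*-distribˡ-+ 2 (suc i) j)) (cong (2 *_) (m+[n∸m]≡n i≤s))
    position : 2 * s ∸ 2 * j ≡ 2 * suc i
    position = trans (cong (_∸ 2 * j) (sym total)) (m+n∸n≡m (2 * suc i) (2 * j))
    j<k : j < k
    j<k = chord-bound j path (s≤s z≤n) (subst (_< L) (sym total) t<L) adj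
      (subst (λ z → Adj (h 0) (h z)) (sym total) closing) refl

-- Degree counting and extremal paths

record Neighbours {n : ℕ} (G : Graph n) (U : Subset n) (K : ℕ) (x : Fin n) : Set where
  field
    neighbour : Fin K → Fin n
    injective : Injective _≡_ _≡_ neighbour
    inside    : ∀ i → neighbour i ∈ U
    adjacent  : ∀ i → Graph.Adj G x (neighbour i)

module Degrees {n : ℕ} (G : Graph n) (U : Subset n) (k : ℕ) (1≤k : 1 ≤ k)
  (even-bound : ∀ (C : Cycle G) j → Cycle.cycleLength C ≡ 2 * j → j ≤ k)
  (K : ℕ) (degree : ∀ {x} → x ∈ U → ¬ ¬ Neighbours G U K x) where
  open Graph G renaming (sym to adj-sym)
  open Cycles G U k 1≤k even-bound public

  -- Distinct neighbours have distinct indices, and no index of a neighbour lies in `as`; together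
  -- these are `length as + K` different numbers below `B`.
  degree-bound : ∀ {x} → x ∈ U → (e : ℕ → Fin n) (B : ℕ) (as : List ℕ) → Unique as →
                 All (_< B) as → All (λ a → ¬ Adj x (e a)) as →
                 (∀ {z} → z ∈ U → Adj x z → ∃ λ q → q < B × z ≡ e q) → length as + K ≤ B
  degree-bound {x} x∈U e B as unique bounded missing cover =
    decidable-stable (_ ≤? _) λ ≰B → degree x∈U (≰B ∘ counted)
    where
    counted : Neighbours G U K x → length as + K ≤ B
    counted N = subst (_≤ B) (trans (length-++ as) (cong (length as +_) (length-tabulate index)))
      (unique-bounded-length
        (Unique.++⁺ unique (Unique.tabulate⁺ index-injective) disjoint)
        (All.++⁺ bounded (All.tabulate⁺ λ i → proj₁ (proj₂ (covered i)))))
      where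
      module N = Neighbours N
      covered : ∀ i → ∃ λ q → q < B × N.neighbour i ≡ e q
      covered i = cover (N.inside i) (N.adjacent i)
      index : Fin K → ℕ
      index i = proj₁ (covered i)
      value : ∀ i → N.neighbour i ≡ e (index i)
      value i = proj₂ (proj₂ (covered i))
      index-injective : ∀ {i j} → index i ≡ index j → i ≡ j
      index-injective {i} {j} eq =
        N.injective (trans (value i) (trans (cong e eq) (sym (value j))))
      disjoint : Disjoint as (tabulate index)
      disjoint (q∈as , q∈index) with ∈-tabulate⁻ q∈index
      ... | i , refl = All.lookup missing q∈as (subst (Adj x) (value i) (N.adjacent i))

  -- Two missing slots would force `2 + K ≤ 2 * k`, against `2 * k ≤ suc K`.
  slot-adjacent : ∀ {h} s {L} → 2 * k ≤ suc K → IsPath h L → 2 * s < L → Adj (h 0) (h (2 * s)) →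
                  Closed h (2 * s) 0 → ∀ {a b} → a ≢ b → a < k + k → b < k + k →
                  Adj (h 0) (slot h s a) ⊎ Adj (h 0) (slot h s b)
  slot-adjacent {h} s 2k≤1+K path t<L closing closed {a} {b} a≢b a< b< =
    decidable-stable (adj? _ _ ⊎-dec adj? _ _) λ neither → <⇒≱
      (degree-bound (inside path (≤-<-trans z≤n t<L)) (slot h s) (k + k) (a ∷ b ∷ [])
        ((a≢b ∷ []) ∷ [] ∷ []) (a< ∷ b< ∷ []) (neither ∘ inj₁ ∷ neither ∘ inj₂ ∷ [])
        (slot-cover s path t<L closing closed))
      (subst (_≤ suc K) (cong (k +_) (+-identityʳ k)) 2k≤1+K)

  unroll-adjacent : ∀ {f} s {L} p r → p + r ≡ 2 * s → 2 * k ≤ suc K → IsPath f L → 2 * s < L →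
                    Adj (f 0) (f (2 * s)) → Closed f (2 * s) p →
                    ∀ {a b} → a ≢ b → a < k + k → b < k + k →
                    Adj (f p) (slot (unroll f p r) s a) ⊎ Adj (f p) (slot (unroll f p r) s b)
  unroll-adjacent {f} s {L} p r total 2k≤1+K path t<L closing closed {a} {b} a≢b a< b< =
    subst (λ z → Adj (f z) (slot h s a) ⊎ Adj (f z) (slot h s b)) (+-identityʳ p)
      (slot-adjacent s 2k≤1+K (unroll-path p path′ closing′) (≤-reflexive (cong suc (sym total)))
        (subst (λ z → Adj (h 0) (h z)) total (unroll-closing p r path′ closing′))
        (subst (λ z → Closed h z 0) total
          (unroll-closed p r (subst (λ z → Closed f z p) (sym total) closed)))
        a≢b a< b<)
    where
    h = unroll f p r
    path′ : IsPath f (suc (p + r))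
    path′ = segment-path 0 path (subst (_< L) (sym total) t<L)
    closing′ : Adj (f (p + r)) (f 0)
    closing′ = adj-sym (subst (λ z → Adj (f 0) (f z)) (sym total) closing)

  -- The path is a longest one, and among the longest paths its first vertex has a
  -- neighbour as far along the path as possible.
  record Extremal (f : ℕ → Fin n) (L t : ℕ) : Set where
    field
      path    : IsPath f L
      t<L     : t < L
      closing : Adj (f 0) (f t)
      maximal : ∀ {g} → IsPath g L → Closed g t 0

  open Extremal

  -- Two nested maximisations: first the number of vertices, then the furthest neighbour of the
  -- first vertex. Some neighbour exists as `0 < K`, and it lies on the path, since otherwise it
  -- could be prepended.
  extremal-exists : ∀ {x} → x ∈ U → 0 < K → ¬ ¬ ∃ λ f → ∃₂ (Extremal f)
  extremal-exists {x} x∈U 0<K none = maximum-exists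
    {A = ∃₂ λ f L → 0 < L × IsPath f L} (proj₁ ∘ proj₂) n (λ (_ , _ , _ , p) → path-length p)
    ((λ _ → x) , 1 , s≤s z≤n , singleton x∈U)
    λ ((f , L , 0<L , p) , longest) → degree (inside p 0<L) λ N →
      let module N = Neighbours N
          first = fromℕ< 0<K
          (t , t<L , eq) = on-path longest p (N.inside first) (N.adjacent first)
      -- The maximum is over all paths with `L` vertices, so that `t` also serves every rotated
      -- path.
      in maximum-exists {A = ∃₂ λ g t → IsPath g L × t < L × Adj (g 0) (g t)}
        (proj₁ ∘ proj₂) L (λ (_ , _ , _ , t<L , _) → <⇒≤ t<L)
        (f , t , p , t<L , subst (Adj (f 0)) eq (N.adjacent first))
        λ ((g , t , q , t<L , adj) , furthest) → none (g , L , t , record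
          { path = q ; t<L = t<L ; closing = adj
          ; maximal = λ {g′} q′ z∈U adj′ →
              let (i , i<L , eq′) = on-path longest q′ z∈U adj′
              in i , furthest (g′ , i , q′ , i<L , subst (Adj (g′ 0)) eq′ adj′) , eq′ })
    where
    singleton : ∀ {z} → z ∈ U → IsPath (λ _ → z) 1
    singleton z∈U = record
      { inj    = λ i<1 j<1 _ → trans (n<1⇒n≡0 i<1) (sym (n<1⇒n≡0 j<1))
      ; step   = λ i<0 → contradiction (s≤s⁻¹ i<0) λ ()
      ; inside = λ _ → z∈U }
    on-path : ∀ {L} → (∀ ((_ , L′ , _) : ∃₂ λ f L → 0 < L × IsPath f L) → L′ ≤ L) →
              ∀ {g} → IsPath g L → ∀ {z} → z ∈ U → Adj (g 0) z → ∃ λ q → q < L × z ≡ g q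
    on-path {L} longest {g} p {z} z∈U adj with Fin.any? {n = L} (λ q → z Fin.≟ g (toℕ q))
    ... | yes (q , eq) = toℕ q , Fin.toℕ<n q , eq
    ... | no  z∉g = contradiction (longest (_ , suc L , s≤s z≤n , extended)) (<-irrefl refl)
      where
      extended : IsPath (join (λ _ → z) 1 g) (suc L)
      extended = join-path (singleton z∈U) p
        (λ _ j<L eq → z∉g (fromℕ< j<L , trans eq (cong g (sym (Fin.toℕ-fromℕ< j<L)))))
        λ _ → adj-sym adj

  -- The rotated path has `L` vertices too and starts at `g i`, so `maximal` applies to it.
  closed-rotate : ∀ {f L t g i} → Extremal f L t → IsPath g L → i < t →
                  Adj (g 0) (g (suc i)) → Closed g t i
  closed-rotate {g = g} E p i<t chord z∈U adj
    with maximal E (rotate-path p (≤-<-trans i<t (t<L E)) chord) z∈U adj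
  ... | q , q≤t , eq with rotate-range g q i<t q≤t
  ...   | q′ , q′≤t , eq′ = q′ , q′≤t , trans eq eq′

  -- An even extremal index is at most `2 * k`

  module _ {f : ℕ → Fin n} {L s : ℕ} (4≤k : 4 ≤ k) (2k≤1+K : 2 * k ≤ suc K)
           (E : Extremal f L (2 * s)) where

    OddChord : ℕ → Set
    OddChord e = Adj (f 0) (f (1 + 2 * e))

    private
      bounded : ∀ {a} → a < k → a < k + k
      bounded a<k = <-≤-trans a<k (m≤m+n k k)

    -- The slots below `k` are exactly the odd positions `1 + 2 * a`, and at most one slot is
    -- missing.
    odd-chord : ∀ a b → a ≢ b → a < k → b < k → OddChord a ⊎ OddChord b
    odd-chord a b a≢b a<k b<k =
      subst₂ (λ y z → Adj (f 0) y ⊎ Adj (f 0) z) (join-< _ k _ a<k) (join-< _ k _ b<k)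
        (slot-adjacent s 2k≤1+K (path E) (t<L E) (closing E) (maximal E (path E)) a≢b
          (bounded a<k) (bounded b<k))

    -- The two chords cross and, with the path between them, span an even cycle on `2 * (e + j) + 2`
    -- vertices.
    crossing-free : ∀ e j → OddChord e → k ≤ e + j → 1 + 2 * (e + j) < L →
                    ¬ Adj (f (2 * e)) (f (1 + 2 * (e + j)))
    crossing-free e j chord k≤e+j in-range adj = <⇒≱
      (chord-bound (e + j) (path E) (n<1+n (2 * e)) (subst (_< L) eq in-range) chord
        (subst (λ z → Adj (f (2 * e)) (f z)) eq adj) (sym (*-distribˡ-+ 2 e j)))
      k≤e+j
      where
      eq : 1 + 2 * (e + j) ≡ 1 + 2 * e + 2 * j
      eq = cong suc (*-distribˡ-+ 2 e j)

    -- Rotation makes `f (2 * e)` a first vertex. On the cycle unrolled from there, the slots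
    -- `k - e` and `k - e + 1` are both forbidden by `crossing-free`. They are below `k` because
    -- `2 ≤ e`, and they do not wrap past `f (2 * s)` because `suc k < s`.
    far-contradiction : ∀ e j → 2 ≤ e → e + suc j ≡ k → suc k < s → OddChord e → ⊥
    far-contradiction e j 2≤e e+j≡k k+1<s chord =
      [ refute (suc j) (≤-reflexive (sym e+j≡k)) (n≤1+n _)
      , refute (suc (suc j)) (subst (_≤ e + suc (suc j)) e+j≡k (+-monoʳ-≤ e (n≤1+n _))) ≤-refl ]′
      (unroll-adjacent s p r total 2k≤1+K (path E) (t<L E) (closing E) p-closed
        (λ ()) (bounded (j<k (n≤1+n _))) (bounded (j<k ≤-refl)))
      where
      p = 2 * e
      e<k : e < k
      e<k = subst (e <_) e+j≡k (m<m+n e (s≤s z≤n))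
      e≤s : e ≤ s
      e≤s = ≤-trans (<⇒≤ e<k) (≤-trans (n≤1+n k) (<⇒≤ k+1<s))
      r = 2 * (s ∸ e)
      total : p + r ≡ 2 * s
      total = trans (sym (*-distribˡ-+ 2 e (s ∸ e))) (cong (2 *_) (m+[n∸m]≡n e≤s))
      p-closed : Closed f (2 * s) p
      p-closed = closed-rotate E (path E) (*-monoʳ-< 2 (<-trans e<k (<-trans (n<1+n k) k+1<s))) chord
      j<k : ∀ {i} → i ≤ suc (suc j) → i < k
      j<k {i} i≤ = subst (i <_) e+j≡k (≤-trans (s≤s i≤) (+-monoˡ-≤ (suc j) 2≤e))
      refute : ∀ i → k ≤ e + i → i ≤ suc (suc j) → ¬ Adj (f p) (slot (unroll f p r) s i)
      refute i k≤e+i i≤ adj = crossing-free e i chord k≤e+i (<-trans position<t (t<L E))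
        (subst (λ z → Adj (f p) z) value adj)
        where
        shift : 2 * e + (1 + 2 * i) ≡ 1 + 2 * (e + i)
        shift = trans (+-suc (2 * e) (2 * i)) (cong suc (sym (*-distribˡ-+ 2 e i)))
        e+i<s : e + i < s
        e+i<s = ≤-<-trans (≤-trans (+-monoʳ-≤ e i≤)
          (≤-reflexive (trans (+-suc e (suc j)) (cong suc e+j≡k)))) k+1<s
        position<t : 1 + 2 * (e + i) < 2 * s
        position<t = ≤-trans (≤-reflexive (sym (*-suc 2 (e + i)))) (*-monoʳ-≤ 2 e+i<s)
        value : slot (unroll f p r) s i ≡ f (1 + 2 * (e + i))
        value = trans (join-< _ k _ (j<k i≤)) (trans
          (join-< (λ j → f (p + j)) (suc r) f (+-cancelˡ-< p _ _
            (subst₂ _<_ (sym shift) (sym (trans (+-suc p r) (cong suc total))) (m<n⇒m<1+n position<t))))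
          (cong f shift))

    -- With `s = k + 1` those slots may wrap, so the vertex `f (2 * k + 1)` next to the end of the
    -- cycle is used instead. Each odd chord `suc e` forbids its edge to `f (2 * suc e)`, so two
    -- such chords leave it with two missing slots.
    near-contradiction : s ≡ suc k → ∀ e₁ j₁ e₂ j₂ → suc e₁ + j₁ ≡ k → suc e₂ + j₂ ≡ k → e₁ ≢ e₂ →
                         OddChord (suc e₁) → OddChord (suc e₂) → ⊥
    near-contradiction refl e₁ j₁ e₂ j₂ eq₁ eq₂ e₁≢e₂ chord₁ chord₂ =
      [ refute e₁ j₁ eq₁ chord₁ , refute e₂ j₂ eq₂ chord₂ ]′
      (unroll-adjacent (suc k) p 1 total 2k≤1+K (path E) (t<L E) (closing E) p-closed
        (e₁≢e₂ ∘ same-offset ∘ +-cancelˡ-≡ k _ _) (slot< e₁ j₁ eq₁) (slot< e₂ j₂ eq₂))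
      where
      p = 1 + 2 * k
      same-offset : j₁ ≡ j₂ → e₁ ≡ e₂
      same-offset refl = suc-injective (+-cancelʳ-≡ j₁ (suc e₁) (suc e₂) (trans eq₁ (sym eq₂)))
      total : p + 1 ≡ 2 * suc k
      total = trans (+-comm p 1) (sym (*-suc 2 k))
      p-closed : Closed f (2 * suc k) p
      p-closed = closed-rotate E (path E) (≤-reflexive (sym (*-suc 2 k)))
        (subst (λ z → Adj (f 0) (f z)) (*-suc 2 k) (closing E))
      slot< : ∀ e j → suc e + j ≡ k → k + j < k + k
      slot< e j eq = +-monoʳ-< k (subst (j <_) eq (s≤s (m≤n+m j e)))
      refute : ∀ e j → suc e + j ≡ k → OddChord (suc e) →
               ¬ Adj (f p) (slot (unroll f p 1) (suc k) (k + j))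
      refute e j eq chord adj = crossing-free (suc e) j chord (≤-reflexive (sym eq))
        (≤-<-trans (subst (λ z → 1 + 2 * z ≤ 2 * suc k) (sym eq)
          (≤-trans (n≤1+n p) (≤-reflexive (sym (*-suc 2 k))))) (t<L E))
        (adj-sym (subst₂ (λ y z → Adj (f (1 + 2 * y)) z) (sym eq) value adj))
        where
        -- The unrolled cycle begins `f (2 * k + 1)`, `f (2 * k + 2)`, `f 0`, so its indices from 2
        -- on are shifted by 2.
        position : 2 * suc k ∸ 2 * j ≡ 2 + 2 * suc e
        position = trans (cong (_∸ 2 * j) (trans (cong (λ z → 2 * suc z) (sym eq)) (distribute e j)))
          (m+n∸n≡m (2 + 2 * suc e) (2 * j))
          where
          distribute : ∀ e j → 2 * suc (suc e + j) ≡ 2 + 2 * suc e + 2 * j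
          distribute = solve-∀
        value : slot (unroll f p 1) (suc k) (k + j) ≡ f (2 * suc e)
        value = trans (join-+ _ k _ j) (cong (unroll f p 1) position)

    -- Since `4 ≤ k`, at most one of the odd chords 1, 2, 3 is missing: one of 2 and 3 serves the
    -- far case, two of the three serve the near case.
    odd-cycle-bound : s ≤ k
    odd-cycle-bound = ≮⇒≥ λ k<s → [ far , near ]′ (m≤n⇒m<n∨m≡n k<s)
      where
      1<k = ≤-trans (s≤s (s≤s z≤n)) 4≤k
      2<k = ≤-trans (s≤s (s≤s (s≤s z≤n))) 4≤k
      d = k ∸ 4
      k≡ : 4 + d ≡ k
      k≡ = m+[n∸m]≡n 4≤k
      far : suc k < s → ⊥
      far k+1<s = [ far-contradiction 2 (suc d) ≤-refl k≡ k+1<s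
                  , far-contradiction 3 d (n≤1+n 2) k≡ k+1<s ]′ (odd-chord 2 3 (λ ()) 2<k 4≤k)
      near : suc k ≡ s → ⊥
      near k+1≡s = [ (λ c₁ → [ (λ c₂ → clash 0 (3 + d) 1 (2 + d) k≡ k≡ (λ ()) c₁ c₂)
                             , (λ c₃ → clash 0 (3 + d) 2 (1 + d) k≡ k≡ (λ ()) c₁ c₃) ]′
                             (odd-chord 2 3 (λ ()) 2<k 4≤k))
                   , (λ c₂ → [ (λ c₁ → clash 0 (3 + d) 1 (2 + d) k≡ k≡ (λ ()) c₁ c₂)
                             , (λ c₃ → clash 1 (2 + d) 2 (1 + d) k≡ k≡ (λ ()) c₂ c₃) ]′
                             (odd-chord 1 3 (λ ()) 1<k 4≤k)) ]′
                   (odd-chord 1 2 (λ ()) 1<k 2<k)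
        where clash = near-contradiction (sym k+1≡s)

-- Critical vertex sets

ColourableOn : {n : ℕ} → Graph n → Subset n → ℕ → Set
ColourableOn {n} G U K =
  ∃ λ (c : Fin n → Fin K) → ∀ {u v} → u ∈ U → v ∈ U → Graph.Adj G u v → c u ≢ c v

Critical : {n : ℕ} → Graph n → Subset n → ℕ → Set
Critical G U K = (∀ {V} → V ⊂ U → ¬ ¬ ColourableOn G V K) × ¬ ColourableOn G U K

module _ {n : ℕ} (G : Graph n) {K : ℕ} where
  open Graph G renaming (sym to adj-sym)

  -- Well-founded descent along `⊂`: a subset that is not colourable while all its proper subsets
  -- are would be critical.
  critical-induction : (∀ U → ¬ Critical G U K) → ¬ ¬ Colourable G K
  critical-induction no-critical ¬col =
    go ⊤ (⊂-wellFounded ⊤) λ (c , proper) → ¬col (c , proper ∈⊤ ∈⊤)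
    where
    go : ∀ U → Acc _⊂_ U → ¬ ¬ ColourableOn G U K
    go U (acc smaller) ¬colU = no-critical U ((λ {V} V⊂U → go V (smaller V⊂U)) , ¬colU)

  critical-nonempty : ∀ {U} → 0 < K → Critical G U K → ∃ (_∈ U)
  critical-nonempty {U} 0<K (_ , ¬col) with nonempty? U
  ... | yes nonempty = nonempty
  ... | no  empty    = contradiction ((λ _ → fromℕ< 0<K) , λ {u} {v} u∈U → ⊥-elim (empty (_ , u∈U))) ¬col

  -- If some colour were missing around x, a colouring of U - x would extend to x.
  critical-degree : ∀ {U} → Critical G U K → ∀ {x} → x ∈ U → ¬ ¬ Neighbours G U K x
  critical-degree {U} (smaller , ¬col) {x} x∈U ¬N = smaller (x∈p⇒p-x⊂p x∈U) λ (c , proper) →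
    let coloured? = λ j → Fin.any? λ z → (z ∈? U) ×-dec adj? x z ×-dec (c z Fin.≟ j)
    in extend c proper (Fin.¬∀⟶∃¬ K _ coloured? λ all → ¬N (record
         { neighbour = proj₁ ∘ all
         ; injective = λ {i} {j} eq →
             let colour = λ i → proj₂ (proj₂ (proj₂ (all i)))
             in trans (sym (colour i)) (trans (cong c eq) (colour j))
         ; inside    = λ i → proj₁ (proj₂ (all i))
         ; adjacent  = λ i → proj₁ (proj₂ (proj₂ (all i))) }))
    where
    extend : (c : Fin n → Fin K) →
             (∀ {u v} → u ∈ U - x → v ∈ U - x → Adj u v → c u ≢ c v) →
             ¬ ∃ λ j → ¬ ∃ λ z → z ∈ U × Adj x z × c z ≡ j
    extend c proper (j , free) = ¬col (c′ , proper′)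
      where
      c′ : Fin n → Fin K
      c′ z with z Fin.≟ x
      ... | yes _ = j
      ... | no  _ = c z
      proper′ : ∀ {u v} → u ∈ U → v ∈ U → Adj u v → c′ u ≢ c′ v
      proper′ {u} {v} u∈U v∈U adj eq with u Fin.≟ x | v Fin.≟ x
      ... | yes refl | yes refl = irrefl refl adj
      ... | yes refl | no  _    = free (v , v∈U , adj , sym eq)
      ... | no  _    | yes refl = free (u , u∈U , adj-sym adj , eq)
      ... | no  u≢x  | no  v≢x  =
        proper (x∈p∧x≢y⇒x∈p-y u∈U u≢x) (x∈p∧x≢y⇒x∈p-y v∈U v≢x) adj eq

  clique-bound : ∀ {w} → IsCliqueNumber G w → (g : Fin m → Fin n) → Injective _≡_ _≡_ g →
                 (∀ {i j} → i ≢ j → Adj (g i) (g j)) → m ≤ w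
  clique-bound {w = w} (_ , greatest) g g-injective adjacent = ≤-trans
    (injection⇒≤∣∣ g g-injective λ i → ∈-comprehension⁺ image? (i , refl))
    (greatest ∣ S ∣ (S , clique , refl))
    where
    image? : Decidable λ x → ∃ λ i → g i ≡ x
    image? x = Fin.any? λ i → g i Fin.≟ x
    S = comprehension image?
    clique : IsClique G S
    clique u∈S v∈S u≢v with ∈-comprehension⁻ image? u∈S | ∈-comprehension⁻ image? v∈S
    ... | i , refl | j , refl = adjacent (u≢v ∘ cong g)

-- Contradictions from a critical set

module CriticalGraph {n : ℕ} (G : Graph n) (U : Subset n) (k : ℕ) (1≤k : 1 ≤ k)
  (even-bound : ∀ (C : Cycle G) j → Cycle.cycleLength C ≡ 2 * j → j ≤ k)
  (K : ℕ) (critical : Critical G U K) where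
  open Graph G renaming (sym to adj-sym)
  open Degrees G U k 1≤k even-bound K (critical-degree G critical) public
  open Extremal

  -- Of the `suc t` positions, `i` itself is always missing by irreflexivity, which brings the bound
  -- down to `t`.
  closed-degree : ∀ {f L t i} → Extremal f L t → i ≤ t → Closed f t i →
                  (as : List ℕ) → Unique (i ∷ as) → All (_≤ t) as →
                  All (λ a → ¬ Adj (f i) (f a)) as → length as + K ≤ t
  closed-degree {f} {t = t} {i} E i≤t closed as unique bounded missing = s≤s⁻¹
    (degree-bound (inside (path E) (≤-<-trans i≤t (t<L E))) f (suc t) (i ∷ as) unique
      (s≤s i≤t ∷ All.map s≤s bounded) ((λ adj → irrefl refl adj) ∷ missing)
      λ z∈U adj → let (q , q≤t , eq) = closed z∈U adj in q , s≤s q≤t , eq)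

  degree≤t : ∀ {f L t} → Extremal f L t → K ≤ t
  degree≤t E = closed-degree E z≤n (maximal E (path E)) [] ([] ∷ []) [] []

  -- For even `t` all neighbours of `f 0` lie in the `k + k` slots; for odd `t` the chord to `f t`
  -- gives `t < 2 * k`, while `K ≤ t`.
  few-colours : K ≤ 2 * k
  few-colours = decidable-stable (_ ≤? _) λ K≰2k →
    let 0<K = ≤-<-trans z≤n (≰⇒> K≰2k)
    in extremal-exists (proj₂ (critical-nonempty G 0<K critical)) 0<K
      λ (f , L , t , E) → K≰2k (bound E (even-or-odd t))
    where
    bound : ∀ {f L t} → Extremal f L t → (∃ λ j → t ≡ 2 * j ⊎ t ≡ 1 + 2 * j) → K ≤ 2 * k
    bound {f} E (s , inj₁ refl) = subst (K ≤_) (cong (k +_) (sym (+-identityʳ k)))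
      (degree-bound (inside (path E) (≤-<-trans z≤n (t<L E))) (slot f s) (k + k) [] [] [] []
        (slot-cover s (path E) (t<L E) (closing E) (maximal E (path E))))
    bound E (j , inj₂ refl) = ≤-trans (degree≤t E) (*-monoʳ-< 2 (chord-bound j (path E) (s≤s z≤n)
      (t<L E) (step (path E) (≤-<-trans (s≤s z≤n) (t<L E))) (closing E) refl))

  closed-unrotate : ∀ {f t i a} → i < t → a ≤ i → Closed (rotate f i) t a → Closed f t (i ∸ a)
  closed-unrotate {f} {i = i} {a} i<t a≤i closed {z} z∈U adj
    with closed z∈U (subst (λ y → Adj y z) (sym (join-< _ (suc i) _ (s≤s a≤i))) adj)
  ... | q , q≤t , eq with rotate-range f q i<t q≤t
  ...   | q′ , q′≤t , eq′ = q′ , q′≤t , trans eq eq′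

  module _ (no-clique : (g : Fin (suc K) → Fin n) → Injective _≡_ _≡_ g →
                        ¬ (∀ {i j} → i ≢ j → Adj (g i) (g j))) where

    -- When `t = K` no position can be missing. So `f 0` sees every later vertex, every `f i` with
    -- `i < K` becomes a first vertex by rotation, and all pairs are adjacent.
    complete-contradiction : ∀ {f L} → ¬ Extremal f L K
    complete-contradiction {f} {L} E = no-clique (f ∘ toℕ)
      (λ {i} {j} eq → Fin.toℕ-injective (inj (path E) (small i) (small j) eq)) pairs
      where
      small : ∀ (i : Fin (suc K)) → toℕ i < L
      small i = ≤-<-trans (s≤s⁻¹ (Fin.toℕ<n i)) (t<L E)
      full : ∀ {i j} → Closed f K i → i ≤ K → j ≤ K → i ≢ j → Adj (f i) (f j)
      full closed i≤K j≤K i≢j = decidable-stable (adj? _ _) λ ¬adj → <-irrefl refl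
        (closed-degree E i≤K closed (_ ∷ []) ((i≢j ∷ []) ∷ [] ∷ []) (j≤K ∷ []) (¬adj ∷ []))
      closed : ∀ {i} → i < K → Closed f K i
      closed i<K = closed-rotate E (path E) i<K
        (full (maximal E (path E)) z≤n i<K λ ())
      pairs : ∀ {i j : Fin (suc K)} → i ≢ j → Adj (f (toℕ i)) (f (toℕ j))
      pairs {i} {j} i≢j with m≤n⇒m<n∨m≡n (s≤s⁻¹ (Fin.toℕ<n i))
      ... | inj₁ i<K = full (closed i<K) (<⇒≤ i<K) (s≤s⁻¹ (Fin.toℕ<n j)) (i≢j ∘ Fin.toℕ-injective)
      -- No rotation used here starts at `f K`; its edges come from the other endpoint.
      ... | inj₂ i≡K = adj-sym (full (closed j<K) (<⇒≤ j<K) (≤-reflexive i≡K)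
                         (i≢j ∘ sym ∘ Fin.toℕ-injective))
        where
        j<K : toℕ j < K
        j<K = ≤∧≢⇒< (s≤s⁻¹ (Fin.toℕ<n j)) λ j≡K → i≢j (Fin.toℕ-injective (trans i≡K (sym j≡K)))

    module _ {f : ℕ → Fin n} {L : ℕ} (E : Extremal f L (suc K)) (4≤t : 4 ≤ suc K) where

      private
        t = suc K

      one-missing : ∀ {i a b} → Closed f t i → i ≤ t → a ≤ t → b ≤ t → i ≢ a → i ≢ b → a ≢ b →
                    Adj (f i) (f a) ⊎ Adj (f i) (f b)
      one-missing closed i≤t a≤t b≤t i≢a i≢b a≢b =
        decidable-stable (adj? _ _ ⊎-dec adj? _ _) λ neither → <-irrefl refl
          (closed-degree E i≤t closed (_ ∷ _ ∷ []) ((i≢a ∷ i≢b ∷ []) ∷ (a≢b ∷ []) ∷ [] ∷ [])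
            (a≤t ∷ b≤t ∷ []) (neither ∘ inj₁ ∷ neither ∘ inj₂ ∷ []))

      -- If f 0 and f (1 + i) are not adjacent, f i still starts a longest path: rotate twice.
      closed-below : ∀ i → i < t → Closed f t i
      closed-below i i<t with adj? (f 0) (f (suc i))
      ... | yes chord = closed-rotate E (path E) i<t chord
      closed-below zero 0<t | no ¬chord =
        contradiction (step (path E) (≤-<-trans 0<t (t<L E))) ¬chord
      closed-below (suc l) i<t | no ¬chord = second l refl
        where
        j = suc (suc l)
        j<t : j < t
        j<t = ≤∧≢⇒< i<t λ j≡t → ¬chord (subst (λ z → Adj (f 0) (f z)) (sym j≡t) (closing E))
        others : ∀ {q} → suc q ≤ t → suc q ≢ j → Adj (f 0) (f (suc q))
        others q≤t q≢j = [ id , (λ chord → contradiction chord ¬chord) ]′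
          (one-missing (maximal E (path E)) z≤n q≤t i<t (λ ()) (λ ()) q≢j)
        second : ∀ l′ → l′ ≡ l → Closed f t (suc l)
        -- The missing chord goes to `f 2`. Rotating at 3 gives `f 3, f 2, f 1, f 0, …`; the edge
        -- from `f 3` to `f 0` then allows a rotation at 2, which starts at `f 1`.
        second zero refl = closed-unrotate 4≤t (s≤s (s≤s z≤n))
          (closed-rotate E (rotate-path (path E) (≤-<-trans 4≤t (t<L E)) (others 4≤t λ ()))
            (≤-trans (n≤1+n 3) 4≤t) (adj-sym (others (≤-trans (n≤1+n 3) 4≤t) λ ())))
        -- Rotating at `j` gives `f j, f (suc l), f l, …`. As `f j` already misses `f 0`, it is
        -- adjacent to `f l`, and a rotation at 1 starts at `f (suc l)`.
        second (suc l′) refl = closed-unrotate j<t (s≤s z≤n)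
          (closed-rotate E (rotate-path (path E) (≤-<-trans j<t (t<L E)) next)
            (≤-trans (s≤s (s≤s z≤n)) 4≤t) back)
          where
          next : Adj (f 0) (f (suc j))
          next = others j<t 1+n≢n
          back : Adj (f j) (f l)
          back = [ (λ chord → contradiction (adj-sym chord) ¬chord) , id ]′
            (one-missing (closed-rotate E (path E) j<t next) (<⇒≤ j<t) z≤n
              (≤-trans (m≤n+m l 2) (<⇒≤ j<t)) (λ ()) (>⇒≢ (m≤n+m (suc l) 1)) (λ ()))

      private
        v : Fin (suc t) → Fin n
        v = f ∘ toℕ

        v-injective : Injective _≡_ _≡_ v
        v-injective {i} {j} eq = Fin.toℕ-injective (inj (path E)
          (≤-<-trans (s≤s⁻¹ (Fin.toℕ<n i)) (t<L E)) (≤-<-trans (s≤s⁻¹ (Fin.toℕ<n j)) (t<L E)) eq)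

      NonEdgeAvoiding : Fin (suc t) → Set
      NonEdgeAvoiding x = ∃₂ λ i j → i ≢ x × j ≢ x × i ≢ j × ¬ Adj (v i) (v j)

      -- Leaving out `x`, there remain `suc K` vertices, which cannot form a clique.
      non-edge : ∀ x → NonEdgeAvoiding x
      non-edge x = decidable-stable
        (Fin.any? λ i → Fin.any? λ j →
          ¬? (i Fin.≟ x) ×-dec ¬? (j Fin.≟ x) ×-dec ¬? (i Fin.≟ j) ×-dec ¬? (adj? (v i) (v j)))
        λ none → no-clique (v ∘ punchIn x) (Fin.punchIn-injective x _ _ ∘ v-injective)
          λ {i} {j} i≢j → decidable-stable (adj? _ _) λ ¬adj →
            none (_ , _ , Fin.punchInᵢ≢i x i , Fin.punchInᵢ≢i x j ,
              i≢j ∘ Fin.punchIn-injective x i j , ¬adj)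

      DisjointNonEdges : Set
      DisjointNonEdges = ∃₂ λ p q → ∃₂ λ r s → p ≢ q × r ≢ s × r ≢ p × r ≢ q × s ≢ p × s ≢ q ×
                         ¬ Adj (v p) (v q) × ¬ Adj (v r) (v s)

      -- Avoiding `f t` makes `q` subject to `closed-below`, so `p` is its only missing position. A
      -- second non-edge that avoids `p` therefore avoids `q` as well.
      disjoint-non-edges : DisjointNonEdges
      disjoint-non-edges with non-edge (fromℕ t)
      ... | p , q , _ , q≢t , p≢q , ¬pq with non-edge p
      ...   | r , s , r≢p , s≢p , r≢s , ¬rs =
        p , q , r , s , p≢q , r≢s , r≢p , r≢q , s≢p , s≢q , ¬pq , ¬rs
        where
        q<t : toℕ q < t
        q<t = ≤∧≢⇒< (s≤s⁻¹ (Fin.toℕ<n q)) λ eq → q≢t (Fin.toℕ-injective (trans eq (sym (Fin.toℕ-fromℕ t))))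
        only-p : ∀ {a} → a ≢ p → q ≢ a → Adj (v q) (v a)
        only-p {a} a≢p q≢a = [ (λ qp → contradiction (adj-sym qp) ¬pq) , id ]′
          (one-missing (closed-below (toℕ q) q<t) (<⇒≤ q<t) (s≤s⁻¹ (Fin.toℕ<n p)) (s≤s⁻¹ (Fin.toℕ<n a))
            (p≢q ∘ sym ∘ Fin.toℕ-injective) (q≢a ∘ Fin.toℕ-injective) (a≢p ∘ sym ∘ Fin.toℕ-injective))
        r≢q : r ≢ q
        r≢q refl = ¬rs (only-p s≢p r≢s)
        s≢q : s ≢ q
        s≢q refl = ¬rs (adj-sym (only-p r≢p (r≢s ∘ sym)))

      CycleColouring : Set
      CycleColouring = ∃ λ (κ : Fin (suc t) → Fin K) → ∀ {i j} → Adj (v i) (v j) → κ i ≢ κ j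

      -- The cycle has `K + 2` vertices; giving each of two disjoint non-edges a single colour saves
      -- two.
      cycle-colouring : DisjointNonEdges → CycleColouring
      cycle-colouring (p , q , r , s , p≢q , r≢s , r≢p , r≢q , s≢p , s≢q , ¬pq , ¬rs)
        with merge₂ p≢q r≢s r≢p r≢q s≢p s≢q
      ... | κ , κ-injective = κ , proper
        where
        proper : ∀ {i j} → Adj (v i) (v j) → κ i ≢ κ j
        proper adj eq with κ-injective eq
        ... | inj₁ refl                        = irrefl refl adj
        ... | inj₂ (inj₁ (inj₁ (refl , refl))) = ¬pq adj
        ... | inj₂ (inj₁ (inj₂ (refl , refl))) = ¬pq (adj-sym adj)
        ... | inj₂ (inj₂ (inj₁ (refl , refl))) = ¬rs adj
        ... | inj₂ (inj₂ (inj₂ (refl , refl))) = ¬rs (adj-sym adj)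

      private
        -- The index runs over `Fin t`, so `f t` stays in `rest` and receives an outer colour.
        removed? : Decidable λ x → ∃ λ (i : Fin t) → f (toℕ i) ≡ x
        removed? x = Fin.any? λ i → f (toℕ i) Fin.≟ x

        rest? : Decidable λ x → x ∈ U × ¬ ∃ λ (i : Fin t) → f (toℕ i) ≡ x
        rest? x = (x ∈? U) ×-dec ¬? (removed? x)

        rest : Subset n
        rest = comprehension rest?

        rest⊂U : rest ⊂ U
        rest⊂U = proj₁ ∘ ∈-comprehension⁻ rest? , f 0 , inside (path E) (≤-<-trans z≤n (t<L E)) ,
          λ f0∈rest → proj₂ (∈-comprehension⁻ rest? f0∈rest) (zero , refl)

      -- Only f t has neighbours outside the cycle, so a colouring of the cycle need only
      -- agree with the outer colouring there, up to a permutation of the colours.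
      near-complete-contradiction : ⊥
      near-complete-contradiction = proj₁ critical rest⊂U λ (c , proper) →
        proj₂ critical (recolour (cycle-colouring disjoint-non-edges) c proper)
        where
        recolour : CycleColouring → (c : Fin n → Fin K) →
                   (∀ {u w} → u ∈ rest → w ∈ rest → Adj u w → c u ≢ c w) → ColourableOn G U K
        recolour (κ , κ-proper) c proper = (λ x → colour x (on? x)) , λ {u} {w} u∈U w∈U adj →
          separate (on? u) (on? w) u∈U w∈U adj
          where
          on? : ∀ x → Dec (∃ λ i → v i ≡ x)
          on? x = Fin.any? λ i → v i Fin.≟ x
          τ : Fin K → Fin K
          τ = transpose (κ (fromℕ t)) (c (v (fromℕ t)))
          τ-injective : Injective _≡_ _≡_ τ
          τ-injective eq = trans (sym (transpose-inverse (c (v (fromℕ t))) (κ (fromℕ t))))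
            (trans (cong (transpose (c (v (fromℕ t))) (κ (fromℕ t))) eq)
              (transpose-inverse (c (v (fromℕ t))) (κ (fromℕ t))))
          τ-end : τ (κ (fromℕ t)) ≡ c (v (fromℕ t))
          τ-end rewrite dec-true (κ (fromℕ t) Fin.≟ κ (fromℕ t)) refl = refl
          colour : ∀ x → Dec (∃ λ i → v i ≡ x) → Fin K
          colour x (yes (i , _)) = τ (κ i)
          colour x (no _)        = c x
          off⇒rest : ∀ {x} → x ∈ U → ¬ (∃ λ i → v i ≡ x) → x ∈ rest
          off⇒rest x∈U off = ∈-comprehension⁺ rest? (x∈U , λ (i , eq) →
            off (inject₁ i , trans (cong f (Fin.toℕ-inject₁ i)) eq))
          end∈rest : v (fromℕ t) ∈ rest
          end∈rest = ∈-comprehension⁺ rest?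
            (inside (path E) (subst (_< L) (sym (Fin.toℕ-fromℕ t)) (t<L E)) , λ (i , eq) →
              <-irrefl (trans (inj (path E) (<-trans (Fin.toℕ<n i) (t<L E))
                (subst (_< L) (sym (Fin.toℕ-fromℕ t)) (t<L E)) eq) (Fin.toℕ-fromℕ t)) (Fin.toℕ<n i))
          boundary : ∀ i {x} → x ∈ U → ¬ (∃ λ i → v i ≡ x) → Adj (v i) x → τ (κ i) ≢ c x
          boundary i {x} x∈U off adj with m≤n⇒m<n∨m≡n (s≤s⁻¹ (Fin.toℕ<n i))
          ... | inj₁ i<t = let (q , q≤t , eq) = closed-below (toℕ i) i<t x∈U adj in
            contradiction (fromℕ< (s≤s q≤t) , trans (cong f (Fin.toℕ-fromℕ< (s≤s q≤t))) (sym eq)) off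
          ... | inj₂ i≡t with refl ← Fin.toℕ-injective (trans i≡t (sym (Fin.toℕ-fromℕ t))) =
            λ eq → proper end∈rest (off⇒rest x∈U off) adj (trans (sym τ-end) eq)
          separate : ∀ {u w} (du : Dec (∃ λ i → v i ≡ u)) (dw : Dec (∃ λ i → v i ≡ w)) →
                     u ∈ U → w ∈ U → Adj u w → colour u du ≢ colour w dw
          separate (yes (i , refl)) (yes (j , refl)) _ _ adj = κ-proper adj ∘ τ-injective
          separate (yes (i , refl)) (no w-off) _ w∈U adj     = boundary i w∈U w-off adj
          separate (no u-off) (yes (j , refl)) u∈U _ adj     = boundary j u∈U u-off (adj-sym adj) ∘ sym
          separate (no u-off) (no w-off) u∈U w∈U adj         =
            proper (off⇒rest u∈U u-off) (off⇒rest w∈U w-off) adj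

    -- `K ≤ t ≤ 2 * k ≤ suc K` leaves only `t = K` and `t = suc K`.
    critical-contradiction : 4 ≤ k → 2 * k ≤ suc K → ⊥
    critical-contradiction 4≤k 2k≤1+K =
      extremal-exists (proj₂ (critical-nonempty G 0<K critical)) 0<K λ (f , L , t , E) →
        [ (λ t<1+K → complete-contradiction (subst (Extremal f L)
            (≤-antisym (s≤s⁻¹ t<1+K) (degree≤t E)) E))
        , (λ t≡1+K → near-complete-contradiction (subst (Extremal f L) t≡1+K E) 4≤1+K) ]′
        (m≤n⇒m<n∨m≡n (≤-trans (bound E (even-or-odd t)) 2k≤1+K))
      where
      4≤1+K : 4 ≤ suc K
      4≤1+K = ≤-trans (≤-trans 4≤k (m≤m+n k (k + 0))) 2k≤1+K
      0<K : 0 < K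
      0<K = ≤-trans (s≤s z≤n) (s≤s⁻¹ 4≤1+K)
      bound : ∀ {f L t} → Extremal f L t → (∃ λ j → t ≡ 2 * j ⊎ t ≡ 1 + 2 * j) → t ≤ 2 * k
      bound E (s , inj₁ refl) = *-monoʳ-≤ 2 (odd-cycle-bound {s = s} 4≤k 2k≤1+K E)
      bound E (j , inj₂ refl) = *-monoʳ-< 2 (chord-bound j (path E) (s≤s z≤n)
        (t<L E) (step (path E) (≤-<-trans (s≤s z≤n) (t<L E))) (closing E) refl)

-- Three even cycle lengths, and the theorem

two-values : ∀ {a b x y z : ℕ} → x ≡ a ⊎ x ≡ b → y ≡ a ⊎ y ≡ b → z ≡ a ⊎ z ≡ b →
             x ≢ y → x ≢ z → ¬ y ≢ z
two-values (inj₁ refl) (inj₁ refl) _           x≢y _   _   = x≢y refl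
two-values (inj₁ refl) (inj₂ refl) (inj₁ refl) _   x≢z _   = x≢z refl
two-values (inj₁ refl) (inj₂ refl) (inj₂ refl) _   _   y≢z = y≢z refl
two-values (inj₂ refl) (inj₁ refl) (inj₁ refl) _   _   y≢z = y≢z refl
two-values (inj₂ refl) (inj₁ refl) (inj₂ refl) _   x≢z _   = x≢z refl
two-values (inj₂ refl) (inj₂ refl) _           x≢y _   _   = x≢y refl

module _ {n : ℕ} (G : Graph n) {k : ℕ} (longest : ∀ m → Lₑ G m → m ≤ k * 2) where

  longest⇒even-bound : ∀ (C : Cycle G) j → Cycle.cycleLength C ≡ 2 * j → j ≤ k
  longest⇒even-bound C j eq = *-cancelʳ-≤ j k 2
    (subst (_≤ k * 2) eq′ (longest _ (divides j eq′ , C , refl)))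
    where eq′ = trans eq (*-comm 2 j)

  -- If `k ≤ 3`, an even cycle has length 4 or 6, too few for three distinct lengths.
  three-lengths⇒4≤k : ∀ {c} → HasCardinality (Lₑ G) c → 3 ≤ c → 4 ≤ k
  three-lengths⇒4≤k (xs , unique , elements , refl) 3≤c = ≰⇒> λ k≤3 →
    contradict k≤3 xs unique (λ {m} → Equivalence.to (elements m)) 3≤c
    where
    four-or-six : k ≤ 3 → ∀ {m} → Lₑ G m → m ≡ 4 ⊎ m ≡ 6
    four-or-six k≤3 m∈@(divides j refl , C , length≡)
      with j | ≤-trans (*-cancelʳ-≤ j k 2 (longest _ m∈)) k≤3
         | ≤-trans (s≤s (Cycle.2≤k C)) (≤-reflexive length≡)
    ... | 0 | _ | ()
    ... | 1 | _ | s≤s (s≤s ())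
    ... | 2 | _ | _ = inj₁ refl
    ... | 3 | _ | _ = inj₂ refl
    ... | suc (suc (suc (suc _))) | s≤s (s≤s (s≤s ())) | _
    contradict : k ≤ 3 → ∀ xs → Unique xs → (∀ {m} → m ∈ₗ xs → Lₑ G m) → 3 ≤ length xs → ⊥
    contradict k≤3 (x ∷ y ∷ z ∷ _) ((x≢y ∷ x≢z ∷ _) ∷ (y≢z ∷ _) ∷ _) even _ = two-values
      (four-or-six k≤3 (even (here refl))) (four-or-six k≤3 (even (there (here refl))))
      (four-or-six k≤3 (even (there (there (here refl))))) x≢y x≢z y≢z
    contradict _ (_ ∷ [])     _ _ (s≤s ())
    contradict _ (_ ∷ _ ∷ []) _ _ (s≤s (s≤s ()))

theorem10 : ∀ {n : ℕ} (G : Graph n) → Connected G → ∃ (Lₑ G) →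
    ∀ {χ w ℓₑ ∣Lₑ∣ : ℕ} →
    IsChromaticNumber G χ →
    IsCliqueNumber G w →
    IsLongestEvenCycleLength G ℓₑ →
    HasCardinality (Lₑ G) ∣Lₑ∣ →
    (χ ≤ ℓₑ + 1) ×
    (w ≤ ℓₑ → 3 ≤ ∣Lₑ∣ → χ ≤ ℓₑ) ×
    (w ≤ ℓₑ ∸ 1 → 3 ≤ ∣Lₑ∣ → χ ≤ ℓₑ ∸ 1)
theorem10 G _ _ {χ} {w} (_ , least) clique ((divides k refl , C , length≡) , longest) card =
    colours (λ U critical → <⇒≱ (≤-reflexive (trans (cong suc (*-comm 2 k)) (+-comm 1 (k * 2))))
      (CriticalGraph.few-colours G U k 1≤k even-bound (k * 2 + 1) critical))
  , (λ w≤ℓ 3≤c → colours (no-critical (k * 2) w≤ℓ 3≤c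
      (≤-trans (≤-reflexive (*-comm 2 k)) (n≤1+n _))))
  -- This is the smallest number of colours for which `2 * k ≤ suc K` still holds.
  , (λ w≤ℓ-1 3≤c → colours (no-critical (k * 2 ∸ 1) w≤ℓ-1 3≤c
      (≤-trans (≤-reflexive (*-comm 2 k)) (m≤n+m∸n (k * 2) 1))))
  where
  even-bound = longest⇒even-bound G longest
  1≤k : 1 ≤ k
  -- For `k = 0` the longest even cycle would have length 0.
  1≤k = n≢0⇒n>0 λ where refl → contradiction length≡ λ ()
  colours : ∀ {K} → (∀ U → ¬ Critical G U K) → χ ≤ K
  colours none = decidable-stable (_ ≤? _) λ χ≰K → critical-induction G none (χ≰K ∘ least _)
  no-critical : ∀ K → w ≤ K → 3 ≤ _ → 2 * k ≤ suc K → ∀ U → ¬ Critical G U K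
  no-critical K w≤K 3≤c 2k≤1+K U critical =
    CriticalGraph.critical-contradiction G U k 1≤k even-bound K critical
      (λ g g-injective adjacent → <-irrefl refl
        (≤-trans (clique-bound G {K} clique g g-injective adjacent) w≤K))
      (three-lengths⇒4≤k G longest card 3≤c) 2k≤1+K
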